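{- Let $\mathfrak U\mathfrak U$ be the category of univalent updown categories and $\mathfrak W$ the category of weighted-relation posets. There is a functor $Wrp:\mathfrak U\mathfrak U\to\mathfrak W$ sending a univalent updown category $\mathcal C$ to the set $\operatorname{Ob}\mathcal C$ with the partial order $p\preceq q\iff\operatorname{Hom}(p,q)\ne\emptyset$ and the weight function $n(x,y)=u(x;y)=d(x;y)$.
   Context: An updown category is a small category $\mathcal C$ with a rank functor $|\cdot|:\mathcal C\to\mathbb N$ (where $\mathbb N=\{0,1,2,\dots\}$ is the ordered set of natural numbers regarded as a category) such that: (A1) each rank $\mathcal C_n=\{p\in\operatorname{Ob}\mathcal C:|p|=n\}$ is finite; (A2) $\mathcal C_0$ consists of a single object $\hat 0$, and $\operatorname{Hom}(\hat 0,p)$ is nonempty for all objects $p$; (A3) for objects $p,p'$, $\operatorname{Hom}(p,p')$ is always finite, and $\operatorname{Hom}(p,p')=\emptyset$ unless $|p|<|p'|$ or $p=p'$; in the latter case $\operatorname{Hom}(p,p)$ is a group, denoted $\operatorname{Aut}(p)$; (A4) any morphism $p\to p'$ with $|p'|=|p|+k$ factors as a composition $p=p_0\to p_1\to\cdots\to p_k=p'$ with $|p_{i+1}|=|p_i|+1$; (A5) if $|p'|=|p|+1$, the actions of $\operatorname{Aut}(p)$ and $\operatorname{Aut}(p')$ on $\operatorname{Hom}(p,p')$ (by precomposition and postcomposition respectively) are free. $\mathcal C$ is univalent if $\operatorname{Aut}(p)$ is trivial for all $p\in\operatorname{Ob}\mathcal C$. A morphism $F:\mathcal C\to\mathcal D$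 of univalent updown categories is a rank-preserving functor such that for all $p,q\in\operatorname{Ob}\mathcal C$ with $|q|=|p|+1$ the induced function $\coprod_{\{q':F(q')=F(q)\}}\operatorname{Hom}(p,q')\to\operatorname{Hom}(F(p),F(q))$ is injective. For objects $p,p'$ with $|p'|=|p|+1$, set $u(p;p')=|\operatorname{Hom}(p,p')|/|\operatorname{Aut}(p')|$ and $d(p;p')=|\operatorname{Hom}(p,p')|/|\operatorname{Aut}(p)|$. Let $U$ be the linear operator on the free vector space $\Bbbk(\operatorname{Ob}\mathcal C)$ over a field $\Bbbk$ of characteristic $0$ with $Up=\sum_{|p'|=|p|+1}u(p;p')p'$, and let $\langle p,p'\rangle=|\operatorname{Aut}(p)|\,\delta_{p,p'}$. For arbitrary $p,p'$ set $u(p;p')=d(p;p')=0$ if $\operatorname{Hom}(p,p')=\emptyset$, and otherwise $u(p;p')=\langle U^{|p'|-|p|}p,p'\rangle/|\operatorname{Aut}(p')|$, $d(p;p')=\langle U^{|p'|-|p|}p,p'\rangle/|\operatorname{Aut}(p)|$. In the univalent case $u=d$. A weighted-relation poset is a ranked poset $P=\bigcup_{n\ge0}P_n$ with a least element $\hat 0\in P_0$, together with nonnegative integers $n(x,y)$ for all $x,y\in P$ such that $n(x,y)=0$ unless $x\preceq y$, and $n(x,y)=\sum_{|z|=k}n(x,z)n(z,y)$ whenever $|x|\le k\le|y|$. A morphism of weighted-relation posets $P,Q$ is a rank-preserving map $f:P\to Q$ such that $n(f(t),f(s))\ge\sum_{s'\in f^{ -1}(f(s))}n(t,s')$ for any $s,t\in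 P$ with $|s|=|t|+1$. -}

module Defs where

open import Algebra.Apartness.Bundles using (HeytingField)
open import Algebra.Bundles using (CommutativeRing)
open import Algebra.Structures using (IsGroup)
import Algebra.Definitions.RawMonoid as RawMonoidDefinitions
open import Data.Bool.Base using (if_then_else_)
open import Data.Fin.Base using (Fin; zero)
import Data.Fin.Properties as Fin
open import Data.List.Base using (List; []; _∷_; [_]; map; concatMap; foldr; allFin; _++_)
open import Data.List.Membership.Propositional using (_∈_)
open import Data.List.Relation.Binary.Permutation.Propositional
  using (_↭_; ↭-refl; ↭-trans; ↭-sym; ↭⇒↭ₛ; prep)
open import Data.List.Relation.Binary.Permutation.Propositional.Properties
  using (shift; map⁺; All-resp-↭)
import Data.List.Relation.Binary.Permutation.Setoid.Properties as SetoidPermutation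
open import Data.List.Relation.Unary.All as All using (All; []; _∷_)
import Data.List.Relation.Unary.All.Properties as All
open import Data.List.Relation.Unary.AllPairs using ([]; _∷_)
open import Data.List.Relation.Unary.Any using (here; there)
open import Data.List.Relation.Unary.Unique.Propositional using (Unique)
import Data.List.Properties as List
open import Data.Nat.Base using (ℕ; zero; suc; _+_; _*_; _∸_; _≤_; _<_; z≤n; NonZero)
import Data.Nat.Properties as ℕ
open import Data.Nat.ListAction using (sum)
open import Data.Nat.ListAction.Properties using (sum-++; sum-↭)
open import Data.Nat.GeneralisedArithmetic using (fold)
open import Data.Product.Base using (Σ; Σ-syntax; ∃; ∃-syntax; _×_; _,_; proj₁; proj₂)
open import Data.Sum.Base using (_⊎_)
open import Function.Base using (_∘′_; id)
open import Function.Bundles using (_↔_; Inverse)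
open import Function.Definitions using (Injective)
open import Level using (Level; _⊔_; 0ℓ) renaming (suc to lsuc)
open import Relation.Binary.Core using (Rel)
open import Relation.Binary.Definitions using (DecidableEquality; Minimum)
open import Relation.Binary.Structures using (IsEquivalence; IsPartialOrder)
import Relation.Binary.Construct.NonStrictToStrict as NonStrictToStrict
open import Relation.Binary.PropositionalEquality
  using (_≡_; _≢_; refl; sym; trans; cong; subst; setoid)
open import Relation.Binary.PropositionalEquality.WithK using (≡-irrelevant)
open import Relation.Nullary using (¬_; Dec; yes; no; ⌊_⌋)
open import Relation.Nullary.Decidable using (decidable-stable; ¬¬-excluded-middle)
open import Relation.Nullary.Negation using (contradiction)

record IsCategory {o ℓ e} {Ob : Set o} (Hom : Ob → Ob → Set ℓ)
                  (_≈_ : ∀ {A B} → Rel (Hom A B) e)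
                  (idm : ∀ {A} → Hom A A)
                  (_∘_ : ∀ {A B C} → Hom B C → Hom A B → Hom A C)
                  : Set (o ⊔ ℓ ⊔ e) where
  field
    equiv     : ∀ {A B} → IsEquivalence (_≈_ {A} {B})
    ∘-resp-≈  : ∀ {A B C} {f f′ : Hom B C} {g g′ : Hom A B} →
                f ≈ f′ → g ≈ g′ → (f ∘ g) ≈ (f′ ∘ g′)
    identityˡ : ∀ {A B} (f : Hom A B) → (idm ∘ f) ≈ f
    identityʳ : ∀ {A B} (f : Hom A B) → (f ∘ idm) ≈ f
    assoc     : ∀ {A B C D} (f : Hom C D) (g : Hom B C) (h : Hom A B) →
                ((f ∘ g) ∘ h) ≈ (f ∘ (g ∘ h))

record Category (o ℓ e : Level) : Set (lsuc (o ⊔ ℓ ⊔ e)) where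
  infix  4 _≈_
  infixr 9 _∘_
  field
    Ob         : Set o
    Hom        : Ob → Ob → Set ℓ
    _≈_        : ∀ {A B} → Rel (Hom A B) e
    idm        : ∀ {A} → Hom A A
    _∘_        : ∀ {A B C} → Hom B C → Hom A B → Hom A C
    isCategory : IsCategory Hom _≈_ idm _∘_
  open IsCategory isCategory public

record IsFunctor {o ℓ e o′ ℓ′ e′} (𝒞 : Category o ℓ e) (𝒟 : Category o′ ℓ′ e′)
                 (F₀ : Category.Ob 𝒞 → Category.Ob 𝒟)
                 (F₁ : ∀ {A B} → Category.Hom 𝒞 A B → Category.Hom 𝒟 (F₀ A) (F₀ B))
                 : Set (o ⊔ ℓ ⊔ e ⊔ e′) where
  private
    module 𝒞 = Category 𝒞
    module 𝒟 = Category 𝒟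
  field
    F-resp-≈     : ∀ {A B} {f g : 𝒞.Hom A B} → f 𝒞.≈ g → F₁ f 𝒟.≈ F₁ g
    identity     : ∀ {A} → F₁ (𝒞.idm {A}) 𝒟.≈ 𝒟.idm
    homomorphism : ∀ {A B C} (g : 𝒞.Hom B C) (f : 𝒞.Hom A B) →
                   F₁ (g 𝒞.∘ f) 𝒟.≈ (F₁ g 𝒟.∘ F₁ f)

Finite : Set → Set
Finite A = ∃[ n ] (A ↔ Fin n)

card : {A : Set} → Finite A → ℕ
card = proj₁

elements : {A : Set} → Finite A → List A
elements (n , A↔Fin) = map (Inverse.from A↔Fin) (allFin n)

inhabited? : {A : Set} → Finite A → Dec A
inhabited? (zero  , A↔Fin) = no λ a → Fin.¬Fin0 (Inverse.to A↔Fin a)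
inhabited? (suc n , A↔Fin) = yes (Inverse.from A↔Fin zero)

card-nonZero : {A : Set} (fin : Finite A) → A → NonZero (card fin)
card-nonZero (zero  , A↔Fin) a = contradiction (Inverse.to A↔Fin a) Fin.¬Fin0
card-nonZero (suc n , A↔Fin) a = _

module Chains {o ℓ e} (𝒞 : Category o ℓ e) (rank : Category.Ob 𝒞 → ℕ) where
  open Category 𝒞

  -- A sequence of k morphisms p = p₀ → p₁ → ⋯ → pₖ = q raising the rank
  -- by 1 at each step.
  data Chain : ℕ → Ob → Ob → Set (o ⊔ ℓ) where
    []   : ∀ {p} → Chain 0 p p
    step : ∀ {k p r q} → Hom p r → rank r ≡ suc (rank p) → Chain k r q → Chain (suc k) p q

  composite : ∀ {k p q} → Chain k p q → Hom p q
  composite []           = idm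
  composite (step f _ c) = composite c ∘ f

-- The small categories here have propositional equality as the equality of
-- morphisms.

record UpDownCategory : Set₁ where
  infixr 9 _∘_
  field
    Ob         : Set
    Hom        : Ob → Ob → Set
    idm        : ∀ {p} → Hom p p
    _∘_        : ∀ {p q r} → Hom q r → Hom p q → Hom p r
    isCategory : IsCategory Hom _≡_ idm _∘_
    rank       : Ob → ℕ
    -- The functor laws are vacuous, as the target ℕ is a thin category.
    rank-functorial : ∀ {p q} → Hom p q → rank p ≤ rank q

  category : Category 0ℓ 0ℓ 0ℓ
  category = record { isCategory = isCategory }

  open Chains category rank public

  field
    rank-finite : ∀ n → Finite (Σ[ p ∈ Ob ] rank p ≡ n)
    0̂           : Ob
    rank-0̂      : rank 0̂ ≡ 0
    0̂-unique    : ∀ p → rank p ≡ 0 → p ≡ 0̂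
    from-0̂      : ∀ p → Hom 0̂ p
    Hom-finite  : ∀ p q → Finite (Hom p q)
    Hom-rank    : ∀ {p q} → Hom p q → rank p < rank q ⊎ p ≡ q
    _⁻¹         : ∀ {p} → Hom p p → Hom p p
    Aut-isGroup : ∀ p → IsGroup _≡_ (_∘_ {p} {p} {p}) idm _⁻¹
    -- Only for rank differences suc k ≥ 1: for difference 0 the only chain is
    -- empty, and automorphisms are not required to be identities.
    factors     : ∀ {p q} k (f : Hom p q) → rank q ≡ rank p + suc k →
                  Σ[ c ∈ Chain (suc k) p q ] composite c ≡ f
    free-pre    : ∀ {p q} → rank q ≡ suc (rank p) → (f : Hom p q) (g : Hom p p) →
                  f ∘ g ≡ f → g ≡ idm
    free-post   : ∀ {p q} → rank q ≡ suc (rank p) → (f : Hom p q) (g : Hom q q) →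
                  g ∘ f ≡ f → g ≡ idm

  objectsOfRank : ℕ → List Ob
  objectsOfRank n = map proj₁ (elements (rank-finite n))

  ∣Hom∣ : Ob → Ob → ℕ
  ∣Hom∣ p q = card (Hom-finite p q)

  ∣Aut∣ : Ob → ℕ
  ∣Aut∣ p = ∣Hom∣ p p

  ∣Aut∣-nonZero : ∀ p → NonZero (∣Aut∣ p)
  ∣Aut∣-nonZero p = card-nonZero (Hom-finite p p) idm

  _≟_ : DecidableEquality Ob
  p ≟ q with rank p ℕ.≟ rank q
  ... | no  r≢ = no λ p≡q → r≢ (cong rank p≡q)
  ... | yes r≡ with rank-finite (rank q)
  ...   | _ , fin with Inverse.to fin (p , r≡) Fin.≟ Inverse.to fin (q , refl)
  ...     | yes i≡ = yes (cong proj₁ (trans (sym (Inverse.strictlyInverseʳ fin (p , r≡)))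
                       (trans (cong (Inverse.from fin) i≡)
                              (Inverse.strictlyInverseʳ fin (q , refl)))))
  ...     | no  i≢ = no λ p≡q → i≢ (cong (Inverse.to fin) (lift p≡q r≡))
    where
    lift : ∀ {p q} → p ≡ q → (r≡ : rank p ≡ rank q) → _≡_ {A = Σ[ p ∈ Ob ] rank p ≡ rank q} (p , r≡) (q , refl)
    lift refl r≡ = cong (_ ,_) (ℕ.≡-irrelevant r≡ refl)

-- Over a Heyting field with tight apartness, being apart from 0# means being
-- invertible; classically _#_ is just inequality.

record CharZeroField c ℓ₁ ℓ₂ : Set (lsuc (c ⊔ ℓ₁ ⊔ ℓ₂)) where
  field
    heytingField : HeytingField c ℓ₁ ℓ₂
  open HeytingField heytingField public
    using (Carrier; _≈_; _#_; 0#; 1#; #⇒invertible)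
    renaming (_+_ to _+ᴷ_; _*_ to _*ᴷ_)
  commutativeRing : CommutativeRing c ℓ₁
  commutativeRing = record { isCommutativeRing = HeytingField.isCommutativeRing heytingField }
  open RawMonoidDefinitions (CommutativeRing.+-rawMonoid commutativeRing)
    renaming (_×_ to _·_)

  ι : ℕ → Carrier
  ι n = n · 1#

  field
    charZero : ∀ n → ι (suc n) # 0#

  -- The multiplicative inverse of ι (suc n) - 0#.
  reciprocal : (n : ℕ) → .{{NonZero n}} → Carrier
  reciprocal (suc n) = proj₁ (#⇒invertible (charZero n))

  _/_ : Carrier → (n : ℕ) → .{{NonZero n}} → Carrier
  a / n = a *ᴷ reciprocal n

module Multiplicities {c ℓ₁ ℓ₂} (𝕜 : CharZeroField c ℓ₁ ℓ₂) (C : UpDownCategory) where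
  open CharZeroField 𝕜
  open UpDownCategory C

  -- Meaningful when rank q ≡ suc (rank p), which is where U₁ uses it.
  u₁ : Ob → Ob → Carrier
  u₁ p q = _/_ (ι (∣Hom∣ p q)) (∣Aut∣ q) {{∣Aut∣-nonZero q}}

  -- Elements of the free vector space 𝕜(Ob C), presented as formal sums
  -- Σ aᵢ pᵢ. Presentations are not reduced; the maps below are defined by
  -- (bi)linear extension and so depend only on the total coefficients.
  FormalSum : Set c
  FormalSum = List (Carrier × Ob)

  ⟦_⟧ : Ob → FormalSum
  ⟦ p ⟧ = [ (1# , p) ]

  U₁ : Ob → FormalSum
  U₁ p = map (λ p′ → u₁ p p′ , p′) (objectsOfRank (suc (rank p)))

  U : FormalSum → FormalSum
  U = concatMap λ (a , p) → map (λ (b , p′) → a *ᴷ b , p′) (U₁ p)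

  ⟨_,_⟩₁ : Ob → Ob → Carrier
  ⟨ p , q ⟩₁ = if ⌊ p ≟ q ⌋ then ι (∣Aut∣ p) else 0#

  ⟨_,_⟩ : FormalSum → FormalSum → Carrier
  ⟨ v , w ⟩ = foldr _+ᴷ_ 0#
    (concatMap (λ (a , p) → map (λ (b , q) → (a *ᴷ b) *ᴷ ⟨ p , q ⟩₁) w) v)

  ⟨U^_,_⟩ : Ob → Ob → Carrier
  ⟨U^ p , q ⟩ = ⟨ fold ⟦ p ⟧ U (rank q ∸ rank p) , ⟦ q ⟧ ⟩

  u d : Ob → Ob → Carrier
  u p q = if ⌊ inhabited? (Hom-finite p q) ⌋
          then _/_ ⟨U^ p , q ⟩ (∣Aut∣ q) {{∣Aut∣-nonZero q}} else 0#
  d p q = if ⌊ inhabited? (Hom-finite p q) ⌋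
          then _/_ ⟨U^ p , q ⟩ (∣Aut∣ p) {{∣Aut∣-nonZero p}} else 0#

record UnivalentUpDownCategory : Set₁ where
  field
    upDownCategory : UpDownCategory
  open UpDownCategory upDownCategory public
  field
    univalent : ∀ {p} (f : Hom p p) → f ≡ idm

  -- p ≼ q ⇔ Hom(p,q) ≠ ∅, nonemptiness being rendered by an inhabitant.
  _≼_ : Rel Ob 0ℓ
  p ≼ q = Hom p q

module UnivalentMultiplicities {c ℓ₁ ℓ₂} (𝕜 : CharZeroField c ℓ₁ ℓ₂) where
  u d : (C : UnivalentUpDownCategory) (p q : UnivalentUpDownCategory.Ob C) →
        CharZeroField.Carrier 𝕜
  u C = Multiplicities.u 𝕜 (UnivalentUpDownCategory.upDownCategory C)
  d C = Multiplicities.d 𝕜 (UnivalentUpDownCategory.upDownCategory C)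

record UnivalentMorphism (C D : UnivalentUpDownCategory) : Set where
  private
    module C = UnivalentUpDownCategory C
    module D = UnivalentUpDownCategory D
  field
    F₀              : C.Ob → D.Ob
    F₁              : ∀ {p q} → C.Hom p q → D.Hom (F₀ p) (F₀ q)
    isFunctor       : IsFunctor C.category D.category F₀ F₁
    rank-preserving : ∀ p → D.rank (F₀ p) ≡ C.rank p

  -- ∐_{q′ : F q′ = F q} Hom(p,q′)
  HomsOver : C.Ob → C.Ob → Set
  HomsOver p q = Σ[ q′ ∈ C.Ob ] (F₀ q′ ≡ F₀ q) × C.Hom p q′

  induced : ∀ p q → HomsOver p q → D.Hom (F₀ p) (F₀ q)
  induced p q (q′ , Fq′≡Fq , f) = subst (D.Hom (F₀ p)) Fq′≡Fq (F₁ f)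

  field
    induced-injective : ∀ {p q} → C.rank q ≡ suc (C.rank p) →
                        Injective _≡_ _≡_ (induced p q)

  Arrow : UpDownCategory → Set
  Arrow E = let open UpDownCategory E in Σ[ p ∈ Ob ] Σ[ q ∈ Ob ] Hom p q

  onArrows : Arrow C.upDownCategory → Arrow D.upDownCategory
  onArrows (p , q , f) = F₀ p , F₀ q , F₁ f

-- Equality of functors on arrows, with their source and target; on identity
-- arrows this includes equality on objects.
_≈ᵁ_ : ∀ {C D} → Rel (UnivalentMorphism C D) 0ℓ
F ≈ᵁ G = ∀ x → UnivalentMorphism.onArrows F x ≡ UnivalentMorphism.onArrows G x

idᵁ : ∀ {C} → UnivalentMorphism C C
idᵁ {C} = record
  { F₀ = id
  ; F₁ = id
  ; isFunctor = record
    { F-resp-≈ = id ; identity = refl ; homomorphism = λ _ _ → refl }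
  ; rank-preserving = λ _ → refl
  ; induced-injective = λ _ → injective
  }
  where
  open UnivalentUpDownCategory C
  injective : ∀ {p q} → Injective {A = Σ[ q′ ∈ Ob ] (q′ ≡ q) × Hom p q′} _≡_ _≡_
              (λ (q′ , e , f) → subst (Hom p) e f)
  injective {x = _ , refl , _} {y = _ , refl , _} refl = refl

infixr 9 _∘ᵁ_

_∘ᵁ_ : ∀ {A B C} → UnivalentMorphism B C → UnivalentMorphism A B → UnivalentMorphism A C
_∘ᵁ_ {A} {B} {C} G F = record
  { F₀ = λ p → G.F₀ (F.F₀ p)
  ; F₁ = λ f → G.F₁ (F.F₁ f)
  ; isFunctor = record
    { F-resp-≈ = cong (λ f → G.F₁ (F.F₁ f))
    ; identity = trans (cong G.F₁ F.identity) G.identity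
    ; homomorphism = λ g f → trans (cong G.F₁ (F.homomorphism g f))
                                   (G.homomorphism (F.F₁ g) (F.F₁ f))
    }
  ; rank-preserving = λ p → trans (G.rank-preserving (F.F₀ p)) (F.rank-preserving p)
  ; induced-injective = λ r → injective r _ _
  }
  where
  module A = UnivalentUpDownCategory A
  module B = UnivalentUpDownCategory B
  module C = UnivalentUpDownCategory C
  module G where
    open UnivalentMorphism G public
    open IsFunctor isFunctor public
  module F where
    open UnivalentMorphism F public
    open IsFunctor isFunctor public

  Over : A.Ob → A.Ob → Set
  Over p q = Σ[ q′ ∈ A.Ob ] (G.F₀ (F.F₀ q′) ≡ G.F₀ (F.F₀ q)) × A.Hom p q′

  unpack : ∀ {p q b b′ e e′ h h′} (eq : _≡_ {A = G.HomsOver p q} (b , e , h) (b′ , e′ , h′)) →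
           h ≡ subst (B.Hom p) (sym (cong proj₁ eq)) h′
  unpack refl = refl

  forget : ∀ {p q q′ q″ t e′ e″} {f′ : A.Hom p q′} {f″ : A.Hom p q″} →
           _≡_ {A = F.HomsOver p q′} (q′ , refl , f′) (q″ , t , f″) →
           _≡_ {A = Over p q} (q′ , e′ , f′) (q″ , e″ , f″)
  forget {e′ = e′} {e″ = e″} refl = cong (λ e → _ , e , _) (≡-irrelevant e′ e″)

  injective : ∀ {p q} → A.rank q ≡ suc (A.rank p) → (x y : Over p q) →
              subst (C.Hom (G.F₀ (F.F₀ p))) (proj₁ (proj₂ x)) (G.F₁ (F.F₁ (proj₂ (proj₂ x)))) ≡
              subst (C.Hom (G.F₀ (F.F₀ p))) (proj₁ (proj₂ y)) (G.F₁ (F.F₁ (proj₂ (proj₂ y)))) →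
              x ≡ y
  injective {p} {q} r x y eq = forget (F.induced-injective (trans same-rank r) (unpack images))
    where
    GF-rank : ∀ s → C.rank (G.F₀ (F.F₀ s)) ≡ A.rank s
    GF-rank s = trans (G.rank-preserving (F.F₀ s)) (F.rank-preserving s)
    same-rank : A.rank (proj₁ x) ≡ A.rank q
    same-rank = trans (sym (GF-rank (proj₁ x)))
                  (trans (cong C.rank (proj₁ (proj₂ x))) (GF-rank q))
    images : _≡_ {A = G.HomsOver (F.F₀ p) (F.F₀ q)}
               (F.F₀ (proj₁ x) , proj₁ (proj₂ x) , F.F₁ (proj₂ (proj₂ x)))
               (F.F₀ (proj₁ y) , proj₁ (proj₂ y) , F.F₁ (proj₂ (proj₂ y)))
    images = G.induced-injective
      (trans (F.rank-preserving q) (trans r (cong suc (sym (F.rank-preserving p))))) eq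

𝔘𝔘 : Category (lsuc 0ℓ) 0ℓ 0ℓ
𝔘𝔘 = record
  { Ob  = UnivalentUpDownCategory
  ; Hom = UnivalentMorphism
  ; _≈_ = _≈ᵁ_
  ; idm = idᵁ
  ; _∘_ = _∘ᵁ_
  ; isCategory = record
    { equiv = record
      { refl  = λ _ → refl
      ; sym   = λ F≈G x → sym (F≈G x)
      ; trans = λ F≈G G≈H x → trans (F≈G x) (G≈H x)
      }
    ; ∘-resp-≈ = λ {_} {_} {_} {G} {G′} {F} {F′} G≈G′ F≈F′ x →
        trans (cong (UnivalentMorphism.onArrows G) (F≈F′ x))
              (G≈G′ (UnivalentMorphism.onArrows F′ x))
    ; identityˡ = λ _ _ → refl
    ; identityʳ = λ _ _ → refl
    ; assoc     = λ _ _ _ _ → refl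
    }
  }

-- Σ_{Q z} f z = N, where only finitely many of the z satisfying Q need
-- contribute a nonzero term.
record HasSum {A : Set} (Q : A → Set) (f : A → ℕ) (N : ℕ) : Set where
  field
    support  : List A
    unique   : Unique support
    sound    : All Q support
    complete : ∀ {z} → Q z → f z ≢ 0 → z ∈ support
    total    : sum (map f support) ≡ N

-- Σ_{Q z} f z ≤ N, the sum being the supremum of its finite partial sums.
SumAtMost : {A : Set} (Q : A → Set) (f : A → ℕ) (N : ℕ) → Set
SumAtMost Q f N = ∀ zs → Unique zs → All Q zs → sum (map f zs) ≤ N

record IsRankedPoset {P : Set} (_≼_ : Rel P 0ℓ) (rank : P → ℕ) : Set where
  open NonStrictToStrict _≡_ _≼_ using () renaming (_<_ to _≺_)

  _⋖_ : Rel P 0ℓ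
  x ⋖ y = x ≺ y × (∀ z → ¬ (x ≺ z × z ≺ y))

  field
    isPartialOrder : IsPartialOrder _≡_ _≼_
    rank-monotone  : ∀ {x y} → x ≺ y → rank x < rank y
    rank-cover     : ∀ {x y} → x ⋖ y → rank y ≡ suc (rank x)

record IsWeightedRelationPoset {P : Set} (_≼_ : Rel P 0ℓ) (rank : P → ℕ) (0̂ : P)
                               (n : P → P → ℕ) : Set where
  field
    isRankedPoset : IsRankedPoset _≼_ rank
    0̂-least       : Minimum _≼_ 0̂
    rank-0̂        : rank 0̂ ≡ 0
    n-support     : ∀ {x y} → ¬ (x ≼ y) → n x y ≡ 0
    n-sum         : ∀ x y k → rank x ≤ k → k ≤ rank y →
                    HasSum (λ z → rank z ≡ k) (λ z → n x z * n z y) (n x y)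

record WeightedRelationPoset : Set₁ where
  field
    Carrier : Set
    _≼_     : Rel Carrier 0ℓ
    rank    : Carrier → ℕ
    0̂       : Carrier
    n       : Carrier → Carrier → ℕ
    isWeightedRelationPoset : IsWeightedRelationPoset _≼_ rank 0̂ n

record IsWeightedMorphism (P Q : WeightedRelationPoset)
    (f : WeightedRelationPoset.Carrier P → WeightedRelationPoset.Carrier Q) : Set where
  private
    module P = WeightedRelationPoset P
    module Q = WeightedRelationPoset Q
  field
    rank-preserving : ∀ x → Q.rank (f x) ≡ P.rank x
    n-bound         : ∀ s t → P.rank s ≡ suc (P.rank t) →
                      SumAtMost (λ s′ → f s′ ≡ f s) (P.n t) (Q.n (f t) (f s))

record WeightedMorphism (P Q : WeightedRelationPoset) : Set where
  field
    fun                : WeightedRelationPoset.Carrier P → WeightedRelationPoset.Carrier Q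
    isWeightedMorphism : IsWeightedMorphism P Q fun
  open IsWeightedMorphism isWeightedMorphism public

-- The sums over the fibres of a map f bound the sum over their union. Equality
-- need not be decidable, but the conclusion is ¬¬-stable.
module _ {A B : Set} (f : A → B) (a : A → ℕ) (b : B → ℕ) where

  private
    record Split (w : B) (zs : List A) : Set where
      field
        fibre rest : List A
        perm       : zs ↭ fibre ++ rest
        in-fibre   : All (λ z → f z ≡ w) fibre
        off-fibre  : All (λ z → f z ≢ w) rest

    split : ∀ w zs → ¬ ¬ Split w zs
    split w []       k = k (record { fibre = [] ; rest = [] ; perm = ↭-refl
                                   ; in-fibre = [] ; off-fibre = [] })
    split w (z ∷ zs) k = split w zs λ s → let open Split s in
      ¬¬-excluded-middle λ where
        (yes fz≡w) → k (record { fibre = z ∷ fibre ; rest = rest ; perm = prep z perm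
                               ; in-fibre = fz≡w ∷ in-fibre ; off-fibre = off-fibre })
        (no  fz≢w) → k (record { fibre = fibre ; rest = z ∷ rest
                               ; perm = ↭-trans (prep z perm) (↭-sym (shift z fibre rest))
                               ; in-fibre = in-fibre ; off-fibre = fz≢w ∷ off-fibre })

    Unique-resp-↭ : ∀ {xs ys : List A} → xs ↭ ys → Unique xs → Unique ys
    Unique-resp-↭ p = SetoidPermutation.Unique-resp-↭ (setoid A) (↭⇒↭ₛ p)

    Unique-++⁻ : ∀ xs {ys : List A} → Unique (xs ++ ys) → Unique xs × Unique ys
    Unique-++⁻ []       u       = [] , u
    Unique-++⁻ (x ∷ xs) (x∉ ∷ u) =
      (All.++⁻ˡ xs x∉ ∷ proj₁ (Unique-++⁻ xs u)) , proj₂ (Unique-++⁻ xs u)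

    images : ∀ zs → ¬ ¬ (Σ[ ws ∈ List B ] Unique ws × All (λ w → ∃[ z ] (z ∈ zs × f z ≡ w)) ws
                                          × All (λ z → f z ∈ ws) zs)
    images []       k = k ([] , [] , [] , [])
    images (z ∷ zs) k = images zs λ (ws , u , from , to) →
      let from′ = All.map (λ (z′ , i , e) → z′ , there i , e) from in
      ¬¬-excluded-middle {A = f z ∈ ws} λ where
        (yes i) → k (ws , u , from′ , i ∷ to)
        (no ∉ws) → k ( f z ∷ ws
                     , All.tabulate (λ {w} w∈ws fz≡w → ∉ws (subst (_∈ ws) (sym fz≡w) w∈ws)) ∷ u
                     , (z , here refl , refl) ∷ from′
                     , here refl ∷ All.map there to)

    bound : ∀ ws → (∀ {w} → w ∈ ws → SumAtMost (λ z → f z ≡ w) a (b w)) →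
            ∀ zs → Unique zs → All (λ z → f z ∈ ws) zs →
            ¬ ¬ (sum (map a zs) ≤ sum (map b ws))
    bound []       fib []       u _ k = k z≤n
    bound []       fib (z ∷ zs) u (() ∷ _)
    bound (w ∷ ws) fib zs       u i k = split w zs λ s →
      let open Split s
          uu = Unique-++⁻ fibre (Unique-resp-↭ perm u)
          i′ = All.++⁻ʳ fibre (All-resp-↭ perm i)
          drop : ∀ {z} → f z ∈ (w ∷ ws) × f z ≢ w → f z ∈ ws
          drop = λ { (here e , ne) → contradiction e ne ; (there j , _) → j }
      in bound ws (λ j → fib (there j)) rest (proj₂ uu) (All.map drop (All.zip (i′ , off-fibre)))
         λ le → k (ℕ.≤-trans
           (ℕ.≤-reflexive (trans (sum-↭ (map⁺ a perm))
              (trans (cong sum (List.map-++ a fibre rest)) (sum-++ (map a fibre) (map a rest)))))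
           (ℕ.+-mono-≤ (fib (here refl) fibre (proj₁ uu) in-fibre) le))

  sum-over-fibres : ∀ {Q : B → Set} {N} → SumAtMost Q b N →
                    (∀ z → Q (f z) → SumAtMost (λ z′ → f z′ ≡ f z) a (b (f z))) →
                    SumAtMost (λ z → Q (f z)) a N
  sum-over-fibres {Q} total fib zs u q = decidable-stable (_ ℕ.≤? _) λ k →
    images zs λ (ws , uws , from , to) →
      let Qws = All.map (λ (z , i , e) → z , All.lookup q i , e) from in
      bound ws (λ j → let (z , Qfz , e) = All.lookup Qws j in
                      subst (λ w → SumAtMost (λ z′ → f z′ ≡ w) a (b w)) e (fib z Qfz))
        zs u to
        λ le → k (ℕ.≤-trans le (total ws uws (All.map (λ (_ , Qfz , e) → subst Q e Qfz) Qws)))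

idᵂ : ∀ {P} → WeightedMorphism P P
idᵂ {P} = record
  { fun = id
  ; isWeightedMorphism = record
    { rank-preserving = λ _ → refl
    ; n-bound = λ s t _ → bound s t
    }
  }
  where
  open WeightedRelationPoset P
  bound : ∀ s t → SumAtMost (_≡ s) (n t) (n t s)
  bound s t []            _ _ = z≤n
  bound s t (.s ∷ [])     _ (refl ∷ []) = ℕ.≤-reflexive (ℕ.+-identityʳ _)
  bound s t (_ ∷ _ ∷ _) ((ne ∷ _) ∷ _) (refl ∷ refl ∷ _) = contradiction refl ne

infixr 9 _∘ᵂ_

_∘ᵂ_ : ∀ {P Q R} → WeightedMorphism Q R → WeightedMorphism P Q → WeightedMorphism P R
_∘ᵂ_ {P} {Q} {R} g f = record
  { fun = λ x → g.fun (f.fun x)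
  ; isWeightedMorphism = record
    { rank-preserving = λ x → trans (g.rank-preserving (f.fun x)) (f.rank-preserving x)
    ; n-bound = λ s t r → sum-over-fibres f.fun (P.n t) (Q.n (f.fun t))
        (g.n-bound (f.fun s) (f.fun t)
          (trans (f.rank-preserving s) (trans r (cong suc (sym (f.rank-preserving t))))))
        (λ z gfz≡gfs → f.n-bound z t
          (trans (trans (sym (gf-rank z)) (trans (cong R.rank gfz≡gfs) (gf-rank s))) r))
    }
  }
  where
  module P = WeightedRelationPoset P
  module Q = WeightedRelationPoset Q
  module R = WeightedRelationPoset R
  module f = WeightedMorphism f
  module g = WeightedMorphism g
  gf-rank : ∀ x → R.rank (g.fun (f.fun x)) ≡ P.rank x
  gf-rank x = trans (g.rank-preserving (f.fun x)) (f.rank-preserving x)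

𝔚 : Category (lsuc 0ℓ) 0ℓ 0ℓ
𝔚 = record
  { Ob  = WeightedRelationPoset
  ; Hom = WeightedMorphism
  ; _≈_ = λ f g → ∀ x → WeightedMorphism.fun f x ≡ WeightedMorphism.fun g x
  ; idm = idᵂ
  ; _∘_ = _∘ᵂ_
  ; isCategory = record
    { equiv = record
      { refl  = λ _ → refl
      ; sym   = λ f≈g x → sym (f≈g x)
      ; trans = λ f≈g g≈h x → trans (f≈g x) (g≈h x)
      }
    ; ∘-resp-≈ = λ {_} {_} {_} {g} {g′} {f} {f′} g≈g′ f≈f′ x →
        trans (cong (WeightedMorphism.fun g) (f≈f′ x)) (g≈g′ (WeightedMorphism.fun f′ x))
    ; identityˡ = λ _ _ → refl
    ; identityʳ = λ _ _ → refl
    ; assoc     = λ _ _ _ _ → refl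
    }
  }

wrp : (C : UnivalentUpDownCategory) → let open UnivalentUpDownCategory C in
      (n : Ob → Ob → ℕ) → IsWeightedRelationPoset _≼_ rank 0̂ n → WeightedRelationPoset
wrp C n isWrp = record
  { Carrier = Ob ; _≼_ = _≼_ ; rank = rank ; 0̂ = 0̂ ; n = n
  ; isWeightedRelationPoset = isWrp }
  where open UnivalentUpDownCategory C

wrpMap : ∀ {P Q f} → IsWeightedMorphism P Q f → WeightedMorphism P Q
wrpMap isMor = record { isWeightedMorphism = isMor }

{-# OPTIONS --safe #-}

-- In a univalent category ⟨U^k p, q⟩ is an honest natural number, the number of
-- chains of k rank-raising morphisms from p to q. Cutting a chain at its
-- object of rank k gives the weighted-relation identity, and for rank
-- difference 1 the count is |Hom(p,q)|, so that the injectivity required of a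
-- morphism of updown categories becomes the inequality of weights.
module Submission where

open import Defs
open import Algebra.Bundles using (CommutativeRing)
import Algebra.Properties.Monoid.Mult as MonoidMult
import Algebra.Properties.Ring as RingProperties
import Algebra.Properties.Semiring.Mult as SemiringMult
open import Data.Bool.Base using (if_then_else_)
open import Data.Fin.Base using (Fin; zero; suc)
import Data.Fin.Properties as Fin
open import Data.List.Base using (List; []; _∷_; map; foldr; allFin; length; lookup; _++_)
import Data.List.Properties as List
open import Data.List.Membership.Propositional using (_∈_)
open import Data.List.Membership.Propositional.Properties
  using (∈-map⁺; ∈-map⁻; ∈-allFin; ∈-lookup)
open import Data.List.Relation.Binary.Disjoint.Propositional using (Disjoint)
open import Data.List.Relation.Unary.All as All using (All; []; _∷_)
import Data.List.Relation.Unary.All.Properties as All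
open import Data.List.Relation.Unary.AllPairs using ([]; _∷_)
open import Data.List.Relation.Unary.Any using (here; there)
open import Data.List.Relation.Unary.Unique.Propositional using (Unique)
import Data.List.Relation.Unary.Unique.Propositional.Properties as Unique
open import Data.Nat.Base using (ℕ; zero; suc; _+_; _*_; _∸_; _≤_; _<_; s≤s; NonZero)
open import Data.Nat.GeneralisedArithmetic using (fold)
open import Data.Nat.ListAction using (sum)
import Data.Nat.Properties as ℕ
open import Algebra.Properties.CommutativeSemigroup ℕ.+-commutativeSemigroup using (interchange)
open import Data.Product.Base using (Σ-syntax; _×_; _,_; proj₁; proj₂)
open import Data.Sum.Base using (inj₁; inj₂)
open import Function.Base using (_∘′_)
open import Function.Bundles using (Inverse; Injection)
open import Function.Definitions using (Injective)
open import Function.Properties.Inverse using (↔⇒↣; ↔-sym)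
open import Relation.Binary.PropositionalEquality
  using (_≡_; _≢_; refl; sym; trans; cong; cong₂; subst; isEquivalence; module ≡-Reasoning)
import Relation.Binary.Reasoning.Setoid as SetoidReasoning
open import Relation.Nullary using (¬_; yes; no; ⌊_⌋)
open import Relation.Nullary.Negation using (contradiction)

private
  variable
    A B : Set

-- Finite sums of natural numbers.

sum-cong : ∀ {f g : A → ℕ} xs → (∀ {x} → x ∈ xs → f x ≡ g x) → sum (map f xs) ≡ sum (map g xs)
sum-cong xs f≡g = cong sum (List.map-cong-local (All.tabulate f≡g))

sum-zero : ∀ (f : A → ℕ) xs → (∀ {x} → x ∈ xs → f x ≡ 0) → sum (map f xs) ≡ 0
sum-zero f []       f≡0 = refl
sum-zero f (x ∷ xs) f≡0 = cong₂ _+_ (f≡0 (here refl)) (sum-zero f xs (f≡0 ∘′ there))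

sum-distrib-+ : ∀ (f g : A → ℕ) xs →
                sum (map (λ x → f x + g x) xs) ≡ sum (map f xs) + sum (map g xs)
sum-distrib-+ f g []       = refl
sum-distrib-+ f g (x ∷ xs) =
  trans (cong (f x + g x +_) (sum-distrib-+ f g xs)) (interchange (f x) (g x) _ _)

*-distribˡ-sum : ∀ m (f : A → ℕ) xs → m * sum (map f xs) ≡ sum (map (λ x → m * f x) xs)
*-distribˡ-sum m f []       = ℕ.*-zeroʳ m
*-distribˡ-sum m f (x ∷ xs) =
  trans (ℕ.*-distribˡ-+ m (f x) _) (cong (m * f x +_) (*-distribˡ-sum m f xs))

*-distribʳ-sum : ∀ m (f : A → ℕ) xs → sum (map f xs) * m ≡ sum (map (λ x → f x * m) xs)
*-distribʳ-sum m f []       = refl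
*-distribʳ-sum m f (x ∷ xs) =
  trans (ℕ.*-distribʳ-+ m (f x) _) (cong (f x * m +_) (*-distribʳ-sum m f xs))

sum-comm : ∀ (f : A → B → ℕ) xs ys →
           sum (map (λ x → sum (map (f x) ys)) xs) ≡ sum (map (λ y → sum (map (λ x → f x y) xs)) ys)
sum-comm f []       ys = sym (sum-zero _ ys λ _ → refl)
sum-comm f (x ∷ xs) ys =
  trans (cong (sum (map (f x) ys) +_) (sum-comm f xs ys)) (sym (sum-distrib-+ (f x) _ ys))

-- Collapses sums containing a factor `δ`, at either end of a chain.
sum-supported-at : ∀ (f : A → ℕ) {x xs} → Unique xs → x ∈ xs → (∀ {z} → z ≢ x → f z ≡ 0) →
                   sum (map f xs) ≡ f x
sum-supported-at f {xs = x ∷ xs} (x∉ ∷ _) (here refl) f≡0 =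
  trans (cong (f x +_) (sum-zero f xs λ z∈ → f≡0 (All.lookup x∉ z∈ ∘′ sym))) (ℕ.+-identityʳ _)
sum-supported-at f (x∉ ∷ u) (there x∈) f≡0 =
  cong₂ _+_ (f≡0 (All.lookup x∉ x∈)) (sum-supported-at f u x∈ f≡0)

-- Enumeration and cardinality of finite types.

lookup-injective : ∀ {xs : List A} → Unique xs → Injective _≡_ _≡_ (lookup xs)
lookup-injective (_  ∷ u) {zero}  {zero}  _ = refl
lookup-injective (x∉ ∷ u) {zero}  {suc j} e = contradiction e (All.lookup x∉ (∈-lookup j))
lookup-injective (x∉ ∷ u) {suc i} {zero}  e = contradiction (sym e) (All.lookup x∉ (∈-lookup i))
lookup-injective (_  ∷ u) {suc i} {suc j} e = cong suc (lookup-injective u e)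

to-injective : (fin : Finite A) → Injective _≡_ _≡_ (Inverse.to (proj₂ fin))
to-injective (_ , A↔Fin) = Injection.injective (↔⇒↣ A↔Fin)

from-injective : (fin : Finite A) → Injective _≡_ _≡_ (Inverse.from (proj₂ fin))
from-injective (_ , A↔Fin) = Injection.injective (↔⇒↣ (↔-sym A↔Fin))

elements-unique : (fin : Finite A) → Unique (elements fin)
elements-unique fin = Unique.map⁺ (from-injective fin) (Unique.allFin⁺ (card fin))

∈-elements : (fin : Finite A) (a : A) → a ∈ elements fin
∈-elements (_ , A↔Fin) a = subst (_∈ _) (Inverse.strictlyInverseʳ A↔Fin a)
  (∈-map⁺ (Inverse.from A↔Fin) (∈-allFin (Inverse.to A↔Fin a)))

length-elements : (fin : Finite A) → length (elements fin) ≡ card fin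
length-elements (n , A↔Fin) = trans (List.length-map _ (allFin n)) (List.length-tabulate {n = n} _)

-- Pigeonhole: looking up positions embeds `Fin (length xs)` in `A`, hence in `Fin (card fin)`.
Unique⇒length≤card : (fin : Finite A) {xs : List A} → Unique xs → length xs ≤ card fin
Unique⇒length≤card fin u = Fin.injective⇒≤ (lookup-injective u ∘′ to-injective fin)

¬⇒card≡0 : (fin : Finite A) → ¬ A → card fin ≡ 0
¬⇒card≡0 (zero  , _)     ¬a = refl
¬⇒card≡0 (suc n , A↔Fin) ¬a = contradiction (Inverse.from A↔Fin zero) ¬a

contractible⇒card≡1 : (fin : Finite A) (a : A) → (∀ b → b ≡ a) → card fin ≡ 1
contractible⇒card≡1 fin@(n , A↔Fin) a b≡a = ℕ.≤-antisym
  -- Since any two elements of `A` agree, even the constant map to `Fin 1` is injective.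
  (Fin.injective⇒≤ {f = λ (_ : Fin n) → zero {0}}
    λ _ → from-injective fin (trans (b≡a _) (sym (b≡a _))))
  (Unique⇒length≤card fin {a ∷ []} ([] ∷ []))

-- Counting chains of rank-raising morphisms.

module ChainCount (C : UpDownCategory) where
  open UpDownCategory C

  -- The number of chains of length 0, and in the univalent case the value of the pairing on basis
  -- vectors.
  δ : Ob → Ob → ℕ
  δ p q = if ⌊ p ≟ q ⌋ then 1 else 0

  δ-refl : ∀ p → δ p p ≡ 1
  δ-refl p with p ≟ p
  ... | yes _  = refl
  ... | no p≢p = contradiction refl p≢p

  δ-≢ : ∀ {p q} → p ≢ q → δ p q ≡ 0
  δ-≢ {p} {q} p≢q with p ≟ q
  ... | yes p≡q = contradiction p≡q p≢q
  ... | no _    = refl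

  rank-objectsOfRank : ∀ n → All (λ p → rank p ≡ n) (objectsOfRank n)
  rank-objectsOfRank n = All.map⁺ (All.tabulate λ {x} _ → proj₂ x)

  ∈-objectsOfRank⁻ : ∀ {n p} → p ∈ objectsOfRank n → rank p ≡ n
  ∈-objectsOfRank⁻ = All.lookup (rank-objectsOfRank _)

  ∈-objectsOfRank⁺ : ∀ {n p} → rank p ≡ n → p ∈ objectsOfRank n
  ∈-objectsOfRank⁺ {n} {p} r = ∈-map⁺ proj₁ (∈-elements (rank-finite n) (p , r))

  objectsOfRank-unique : ∀ n → Unique (objectsOfRank n)
  objectsOfRank-unique n = Unique.map⁺ same-object (elements-unique (rank-finite n))
    where
    same-object : ∀ {x y : Σ[ p ∈ Ob ] rank p ≡ n} → proj₁ x ≡ proj₁ y → x ≡ y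
    same-object {_ , r} {_ , s} refl = cong (_ ,_) (ℕ.≡-irrelevant r s)

  -- The number of elements of `Chain k p q`, computed by recursion on the first morphism so that
  -- finiteness of the type `Chain` never has to be established.
  chains : ℕ → Ob → Ob → ℕ
  chains zero    p q = δ p q
  chains (suc k) p q = sum (map (λ r → ∣Hom∣ p r * chains k r q) (objectsOfRank (suc (rank p))))

  -- If `rank q < rank p`, the truncated difference is 0 and the value is `δ p q`, which vanishes
  -- because the objects differ.
  weight : Ob → Ob → ℕ
  weight p q = chains (rank q ∸ rank p) p q

  -- A nonzero term would need a morphism `p → r` and, by induction, one `r → q`; their composite is
  -- excluded.
  chains-support : ∀ k {p q} → ¬ Hom p q → chains k p q ≡ 0
  chains-support zero    ¬h = δ-≢ λ { refl → ¬h idm }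
  chains-support (suc k) {p} {q} ¬h = sum-zero _ (objectsOfRank (suc (rank p))) λ {r} _ → term r
    where
    term : ∀ r → ∣Hom∣ p r * chains k r q ≡ 0
    term r with inhabited? (Hom-finite p r)
    ... | no ¬f = cong (_* chains k r q) (¬⇒card≡0 (Hom-finite p r) ¬f)
    ... | yes f = trans (cong (∣Hom∣ p r *_) (chains-support k λ g → ¬h (g ∘ f)))
                        (ℕ.*-zeroʳ (∣Hom∣ p r))

  chains-1 : ∀ {p q} → rank q ≡ suc (rank p) → chains 1 p q ≡ ∣Hom∣ p q
  chains-1 {p} {q} r = trans
    (sum-supported-at (λ z → ∣Hom∣ p z * δ z q) (objectsOfRank-unique _) (∈-objectsOfRank⁺ r)
      λ {z} z≢q → trans (cong (∣Hom∣ p z *_) (δ-≢ z≢q)) (ℕ.*-zeroʳ (∣Hom∣ p z)))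
    (trans (cong (∣Hom∣ p q *_) (δ-refl q)) (ℕ.*-identityʳ _))

  -- Every chain of length `j + k` is cut at its object number `j`, which has rank `j + rank p`.
  -- That rank is a variable `m` because it stays fixed while the induction replaces `p` by the next
  -- object.
  chains-+ : ∀ j k p q {m} → m ≡ j + rank p →
             sum (map (λ z → chains j p z * chains k z q) (objectsOfRank m)) ≡ chains (j + k) p q
  chains-+ zero    k p q refl = trans
    (sum-supported-at (λ z → δ p z * chains k z q) (objectsOfRank-unique _) (∈-objectsOfRank⁺ refl)
      λ {z} z≢p → cong (_* chains k z q) (δ-≢ (z≢p ∘′ sym)))
    (trans (cong (_* chains k p q) (δ-refl p)) (ℕ.*-identityˡ _))
  chains-+ (suc j) k p q {m} m≡ = begin
    sum (map (λ z → sum (map (λ r → h r * chains j r z) rs) * chains k z q) zs)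
      ≡⟨ sum-cong zs (λ {z} _ → *-distribʳ-sum (chains k z q) (λ r → h r * chains j r z) rs) ⟩
    sum (map (λ z → sum (map (λ r → h r * chains j r z * chains k z q) rs)) zs)
      ≡⟨ sum-comm (λ z r → h r * chains j r z * chains k z q) zs rs ⟩
    sum (map (λ r → sum (map (λ z → h r * chains j r z * chains k z q) zs)) rs)
      ≡⟨ sum-cong rs (λ {r} _ → sum-cong zs λ {z} _ → ℕ.*-assoc (h r) (chains j r z) (chains k z q)) ⟩
    sum (map (λ r → sum (map (λ z → h r * (chains j r z * chains k z q)) zs)) rs)
      ≡⟨ sum-cong rs (λ {r} _ → *-distribˡ-sum (h r) (λ z → chains j r z * chains k z q) zs) ⟨
    sum (map (λ r → h r * sum (map (λ z → chains j r z * chains k z q) zs)) rs)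
      -- Here `rank r` is `suc (rank p)`, so `m`, which is `suc j + rank p`, is also `j + rank r`.
      ≡⟨ sum-cong rs (λ {r} r∈ → cong (h r *_) (chains-+ j k r q
           (trans m≡ (trans (sym (ℕ.+-suc j (rank p)))
                            (cong (j +_) (sym (∈-objectsOfRank⁻ r∈))))))) ⟩
    sum (map (λ r → h r * chains (j + k) r q) rs) ∎
    where
    open ≡-Reasoning
    h : Ob → ℕ
    h = ∣Hom∣ p
    rs zs : List Ob
    rs = objectsOfRank (suc (rank p))
    zs = objectsOfRank m

  weight-sum : ∀ p q k → rank p ≤ k → k ≤ rank q →
               sum (map (λ z → weight p z * weight z q) (objectsOfRank k)) ≡ weight p q
  weight-sum p q k p≤k k≤q = begin
    sum (map (λ z → weight p z * weight z q) (objectsOfRank k))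
      ≡⟨ sum-cong (objectsOfRank k) (λ {z} z∈ →
           cong (λ m → chains (m ∸ rank p) p z * chains (rank q ∸ m) z q) (∈-objectsOfRank⁻ z∈)) ⟩
    sum (map (λ z → chains (k ∸ rank p) p z * chains (rank q ∸ k) z q) (objectsOfRank k))
      ≡⟨ chains-+ (k ∸ rank p) (rank q ∸ k) p q (sym (ℕ.m∸n+n≡m p≤k)) ⟩
    chains ((k ∸ rank p) + (rank q ∸ k)) p q
      -- Both rank bounds enter here: they make the truncated differences add up to
      -- `rank q ∸ rank p`.
      ≡⟨ cong (λ m → chains m p q) (trans (sym (ℕ.+-∸-comm (rank q ∸ k) p≤k))
           (cong (_∸ rank p) (ℕ.m+[n∸m]≡n k≤q))) ⟩
    weight p q ∎
    where open ≡-Reasoning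

  weight-step : ∀ {p q} → rank q ≡ suc (rank p) → weight p q ≡ ∣Hom∣ p q
  weight-step {p} {q} r = trans (cong (λ m → chains m p q) gap) (chains-1 r)
    where
    gap : rank q ∸ rank p ≡ 1
    gap = trans (cong (_∸ rank p) r) (ℕ.m+n∸n≡m 1 (rank p))

  -- The ranked poset of objects.

  Hom⇒rank< : ∀ {p q} → Hom p q → p ≢ q → rank p < rank q
  Hom⇒rank< f p≢q with Hom-rank f
  ... | inj₁ p<q = p<q
  ... | inj₂ p≡q = contradiction p≡q p≢q

  -- A strict rise of rank along `f` would contradict the weak rise along `g`.
  Hom-antisym : ∀ {p q} → Hom p q → Hom q p → p ≡ q
  Hom-antisym f g with Hom-rank f
  ... | inj₂ p≡q = p≡q
  ... | inj₁ p<q = contradiction (rank-functorial g) (ℕ.<⇒≱ p<q)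

  rank-chain : ∀ {k p q} → Chain k p q → rank q ≡ k + rank p
  rank-chain []           = refl
  rank-chain {suc k} (step _ r c) =
    trans (rank-chain c) (trans (cong (k +_) r) (ℕ.+-suc k _))

  isRankedPoset : IsRankedPoset Hom rank
  isRankedPoset = record
    { isPartialOrder = record
      { isPreorder = record
        { isEquivalence = isEquivalence
        ; reflexive     = λ { refl → idm }
        ; trans         = λ f g → g ∘ f
        }
      ; antisym = Hom-antisym
      }
    ; rank-monotone = λ (f , p≢q) → Hom⇒rank< f p≢q
    ; rank-cover    = λ ((f , p≢q) , none) → cover f p≢q none
    }
    where
    rank<⇒≢ : ∀ {p q} → rank p < rank q → p ≢ q
    rank<⇒≢ p<q refl = ℕ.<-irrefl refl p<q

    NoneBetween : Ob → Ob → Set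
    NoneBetween p q = ∀ z → ¬ ((Hom p z × p ≢ z) × (Hom z q × z ≢ q))

    -- In a chain of two or more steps, the object after the first step has rank strictly between
    -- those of the ends, so it is an intermediate element of the order.
    chain⇒suc-rank : ∀ {k p q} → Chain (suc k) p q → NoneBetween p q → rank q ≡ suc (rank p)
    chain⇒suc-rank (step _ r []) _ = r
    chain⇒suc-rank (step {r = z} f r c@(step {k} _ _ _)) none = contradiction
      ( (f , rank<⇒≢ (ℕ.≤-reflexive (sym r)))
      , (composite c , rank<⇒≢
          (subst (rank z <_) (sym (rank-chain c)) (s≤s (ℕ.m≤n+m (rank z) k)))))
      (none _)

    cover : ∀ {p q} → Hom p q → p ≢ q → NoneBetween p q → rank q ≡ suc (rank p)
    -- The inferred `k` is `rank q ∸ suc (rank p)`: distinctness of `p` and `q` makes the rank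
    -- difference positive, as `factors` demands.
    cover {p} f p≢q = chain⇒suc-rank (proj₁ (factors _ f
      (sym (trans (ℕ.+-suc (rank p) _) (ℕ.m+[n∸m]≡n (Hom⇒rank< f p≢q))))))

  isWeightedRelationPoset : IsWeightedRelationPoset Hom rank 0̂ weight
  isWeightedRelationPoset = record
    { isRankedPoset = isRankedPoset
    ; 0̂-least       = from-0̂
    ; rank-0̂        = rank-0̂
    ; n-support     = λ {p} {q} → chains-support (rank q ∸ rank p)
    ; n-sum         = λ p q k p≤k k≤q → record
      { support  = objectsOfRank k
      ; unique   = objectsOfRank-unique k
      ; sound    = rank-objectsOfRank k
      ; complete = λ r _ → ∈-objectsOfRank⁺ r
      ; total    = weight-sum p q k p≤k k≤q
      }
    }

-- The weight inequality for morphisms.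

module WeightBound {C D : UnivalentUpDownCategory} (F : UnivalentMorphism C D) where
  private
    module C where
      open UnivalentUpDownCategory C public
      open ChainCount upDownCategory public
    module D where
      open UnivalentUpDownCategory D public
      open ChainCount upDownCategory public
  open UnivalentMorphism F

  -- `SumAtMost` bounds partial sums, so only the part of the coproduct over the listed targets is
  -- enumerated. The fibre equations are carried along so that `induced` applies.
  homsOver : ∀ t s zs → All (λ z → F₀ z ≡ F₀ s) zs → List (HomsOver t s)
  homsOver t s []       []       = []
  homsOver t s (z ∷ zs) (e ∷ es) =
    map (λ f → z , e , f) (elements (C.Hom-finite t z)) ++ homsOver t s zs es

  length-homsOver : ∀ t s zs es → length (homsOver t s zs es) ≡ sum (map (C.∣Hom∣ t) zs)
  length-homsOver t s []       []       = refl
  length-homsOver t s (z ∷ zs) (e ∷ es) = trans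
    (List.length-++ (map (λ f → z , e , f) (elements (C.Hom-finite t z))))
    (cong₂ _+_ (trans (List.length-map _ (elements (C.Hom-finite t z)))
                      (length-elements (C.Hom-finite t z)))
               (length-homsOver t s zs es))

  target-homsOver : ∀ t s zs es → All (λ h → proj₁ h ∈ zs) (homsOver t s zs es)
  target-homsOver t s []       []       = []
  target-homsOver t s (z ∷ zs) (e ∷ es) = All.++⁺
    (All.map⁺ (All.tabulate λ _ → here refl))
    (All.map there (target-homsOver t s zs es))

  -- Entries of one block differ in their morphism, entries of different blocks in their target.
  homsOver-unique : ∀ t s zs es → Unique zs → Unique (homsOver t s zs es)
  homsOver-unique t s []       []       _        = []
  homsOver-unique t s (z ∷ zs) (e ∷ es) (z∉ ∷ u) = Unique.++⁺
    (Unique.map⁺ (λ { refl → refl }) (elements-unique (C.Hom-finite t z)))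
    (homsOver-unique t s zs es u)
    disjoint
    where
    disjoint : Disjoint (map (λ f → z , e , f) (elements (C.Hom-finite t z))) (homsOver t s zs es)
    disjoint (h∈ , h∈′) with ∈-map⁻ _ h∈
    ... | _ , _ , refl = All.lookup z∉ (All.lookup (target-homsOver t s zs es) h∈′) refl

  -- Across one rank, weights count morphisms, so the sum is the size of a finite part of the
  -- coproduct; `induced` embeds that part in `D.Hom (F₀ t) (F₀ s)`.
  weight-bound : ∀ s t → C.rank s ≡ suc (C.rank t) →
                 SumAtMost (λ s′ → F₀ s′ ≡ F₀ s) (C.weight t) (D.weight (F₀ t) (F₀ s))
  weight-bound s t r zs u es = begin
    sum (map (C.weight t) zs)
      ≡⟨ sum-cong zs (λ z∈ → C.weight-step (same-rank (All.lookup es z∈))) ⟩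
    sum (map (C.∣Hom∣ t) zs)
      ≡⟨ length-homsOver t s zs es ⟨
    length (homsOver t s zs es)
      ≡⟨ List.length-map (induced t s) (homsOver t s zs es) ⟨
    length (map (induced t s) (homsOver t s zs es))
      ≤⟨ Unique⇒length≤card (D.Hom-finite (F₀ t) (F₀ s))
           (Unique.map⁺ (induced-injective r) (homsOver-unique t s zs es u)) ⟩
    D.∣Hom∣ (F₀ t) (F₀ s)
      ≡⟨ D.weight-step (trans (rank-preserving s)
           (trans r (cong suc (sym (rank-preserving t))))) ⟨
    D.weight (F₀ t) (F₀ s) ∎
    where
    open ℕ.≤-Reasoning
    -- Rank preservation puts the whole fibre over `F₀ s` in the rank of `s`.
    same-rank : ∀ {z} → F₀ z ≡ F₀ s → C.rank z ≡ suc (C.rank t)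
    same-rank {z} e = trans (sym (rank-preserving z))
      (trans (cong D.rank e) (trans (rank-preserving s) r))

-- Comparison with `u` and `d` over the field.

module _ {c ℓ₁ ℓ₂} (𝕜 : CharZeroField c ℓ₁ ℓ₂) where
  open CharZeroField 𝕜
  private module K where
    open CommutativeRing commutativeRing public
    open MonoidMult +-monoid public using (×-homo-+; ×-homo-1)
    open SemiringMult semiring public using (×1-homo-*)
    open RingProperties ring public using (-0#≈0#)
  open SetoidReasoning K.setoid

  ι-+ : ∀ m n → ι (m + n) ≈ ι m +ᴷ ι n
  ι-+ = K.×-homo-+ 1#

  ι-* : ∀ m n → ι (m * n) ≈ ι m *ᴷ ι n
  ι-* = K.×1-homo-*

  -- Apartness gives invertibility of a difference, so `reciprocal 1` is the inverse of this
  -- expression.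
  ι1-0≈1 : ι 1 K.- 0# ≈ 1#
  ι1-0≈1 = K.trans (K.+-congˡ K.-0#≈0#) (K.trans (K.+-identityʳ _) (K.×-homo-1 1#))

  reciprocal-1 : reciprocal 1 ≈ 1#
  reciprocal-1 = begin
    reciprocal 1                  ≈⟨ K.*-identityʳ _ ⟨
    reciprocal 1 *ᴷ 1#            ≈⟨ K.*-congˡ ι1-0≈1 ⟨
    reciprocal 1 *ᴷ (ι 1 K.- 0#)  ≈⟨ proj₁ (proj₂ (#⇒invertible (charZero 0))) ⟩
    1#                            ∎

  -- For univalent categories every division by `∣Aut∣` is of this kind. The nonzero proof is an
  -- explicit argument so as to match whichever one the quotient contains.
  /-identity : ∀ a {n} (nz : NonZero n) → n ≡ 1 → _/_ a n {{nz}} ≈ a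
  /-identity a nz refl = K.trans (K.*-congˡ reciprocal-1) (K.*-identityʳ a)

  module _ (C : UnivalentUpDownCategory) where
    open UnivalentUpDownCategory C
    open Multiplicities 𝕜 upDownCategory
    open ChainCount upDownCategory

    ∣Aut∣≡1 : ∀ p → ∣Aut∣ p ≡ 1
    ∣Aut∣≡1 p = contractible⇒card≡1 (Hom-finite p p) idm univalent

    -- The linear functional with values `φ` on the basis, evaluated on an unreduced presentation.
    extend : (Ob → Carrier) → FormalSum → Carrier
    extend φ v = foldr _+ᴷ_ 0# (map (λ (a , p) → a *ᴷ φ p) v)

    extend-++ : ∀ φ v w → extend φ (v ++ w) ≈ extend φ v +ᴷ extend φ w
    extend-++ φ []      w = K.sym (K.+-identityˡ _)
    extend-++ φ (x ∷ v) w = K.trans (K.+-congˡ (extend-++ φ v w)) (K.sym (K.+-assoc _ _ _))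

    extend-scale : ∀ φ a v → extend φ (map (λ (b , p) → a *ᴷ b , p) v) ≈ a *ᴷ extend φ v
    extend-scale φ a []            = K.sym (K.zeroʳ a)
    extend-scale φ a ((b , p) ∷ v) = begin
      (a *ᴷ b) *ᴷ φ p +ᴷ extend φ (map (λ (b , p) → a *ᴷ b , p) v)
        ≈⟨ K.+-cong (K.*-assoc a b (φ p)) (extend-scale φ a v) ⟩
      a *ᴷ (b *ᴷ φ p) +ᴷ a *ᴷ extend φ v
        ≈⟨ K.distribˡ a _ _ ⟨
      a *ᴷ (b *ᴷ φ p +ᴷ extend φ v) ∎

    extend-cong : ∀ {φ ψ} → (∀ p → φ p ≈ ψ p) → ∀ v → extend φ v ≈ extend ψ v
    extend-cong φ≈ψ []            = K.refl
    extend-cong φ≈ψ ((_ , p) ∷ v) = K.+-cong (K.*-congˡ (φ≈ψ p)) (extend-cong φ≈ψ v)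

    -- Linearity moves `U` from the vector to the functional, where it acts as its transpose.
    extend-U : ∀ φ v → extend φ (U v) ≈ extend (λ p → extend φ (U₁ p)) v
    extend-U φ []            = K.refl
    extend-U φ ((a , p) ∷ v) = K.trans (extend-++ φ (map (λ (b , r) → a *ᴷ b , r) (U₁ p)) (U v))
      (K.+-cong (extend-scale φ a (U₁ p)) (extend-U φ v))

    u₁≈∣Hom∣ : ∀ p q → u₁ p q ≈ ι (∣Hom∣ p q)
    u₁≈∣Hom∣ p q = /-identity _ (∣Aut∣-nonZero q) (∣Aut∣≡1 q)

    -- With `rs` the objects one rank above `p` and `g` counting chains to `q`, the right side is
    -- the recursive clause of `chains`: the transpose of `U` lengthens chains by one.
    extend-ι : ∀ p (g : Ob → ℕ) rs → extend (λ r → ι (g r)) (map (λ r → u₁ p r , r) rs) ≈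
                          ι (sum (map (λ r → ∣Hom∣ p r * g r) rs))
    extend-ι p g []       = K.refl
    extend-ι p g (r ∷ rs) = begin
      u₁ p r *ᴷ ι (g r) +ᴷ extend (λ r → ι (g r)) (map (λ r → u₁ p r , r) rs)
        ≈⟨ K.+-cong (K.*-congʳ (u₁≈∣Hom∣ p r)) (extend-ι p g rs) ⟩
      ι (∣Hom∣ p r) *ᴷ ι (g r) +ᴷ ι (sum (map (λ r → ∣Hom∣ p r * g r) rs))
        ≈⟨ K.+-congʳ (ι-* (∣Hom∣ p r) (g r)) ⟨
      ι (∣Hom∣ p r * g r) +ᴷ ι (sum (map (λ r → ∣Hom∣ p r * g r) rs))
        ≈⟨ ι-+ (∣Hom∣ p r * g r) _ ⟨
      ι (∣Hom∣ p r * g r + sum (map (λ r → ∣Hom∣ p r * g r) rs)) ∎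

    -- Generalised over j because fold applies U last, at the end of the chain,
    -- whereas chains recurses on its first morphism.
    extend-chains-fold : ∀ j k p q →
      extend (λ z → ι (chains j z q)) (fold ⟦ p ⟧ U k) ≈ ι (chains (k + j) p q)
    extend-chains-fold j zero    p q = K.trans (K.+-identityʳ _) (K.*-identityˡ _)
    extend-chains-fold j (suc k) p q = begin
      extend (λ z → ι (chains j z q)) (U (fold ⟦ p ⟧ U k))
        ≈⟨ extend-U _ (fold ⟦ p ⟧ U k) ⟩
      extend (λ r → extend (λ z → ι (chains j z q)) (U₁ r)) (fold ⟦ p ⟧ U k)
        ≈⟨ extend-cong (λ r → extend-ι r (λ z → chains j z q) (objectsOfRank (suc (rank r))))
                       (fold ⟦ p ⟧ U k) ⟩
      extend (λ r → ι (chains (suc j) r q)) (fold ⟦ p ⟧ U k)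
        ≈⟨ extend-chains-fold (suc j) k p q ⟩
      ι (chains (k + suc j) p q)
        ≡⟨ cong (λ m → ι (chains m p q)) (ℕ.+-suc k j) ⟩
      ι (chains (suc k + j) p q) ∎

    ⟨,⟩₁≈δ : ∀ p q → ⟨ p , q ⟩₁ ≈ ι (δ p q)
    ⟨,⟩₁≈δ p q with p ≟ q
    ... | yes _ = K.reflexive (cong ι (∣Aut∣≡1 p))
    ... | no  _ = K.refl

    ⟨,⟦⟧⟩≈extend : ∀ v q → ⟨ v , ⟦ q ⟧ ⟩ ≈ extend (λ p → ι (δ p q)) v
    ⟨,⟦⟧⟩≈extend []            q = K.refl
    ⟨,⟦⟧⟩≈extend ((a , p) ∷ v) q =
      K.+-cong (K.*-cong (K.*-identityʳ a) (⟨,⟩₁≈δ p q)) (⟨,⟦⟧⟩≈extend v q)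

    ⟨U^,⟩≈weight : ∀ p q → ⟨U^ p , q ⟩ ≈ ι (weight p q)
    ⟨U^,⟩≈weight p q = begin
      ⟨ fold ⟦ p ⟧ U k , ⟦ q ⟧ ⟩                     ≈⟨ ⟨,⟦⟧⟩≈extend (fold ⟦ p ⟧ U k) q ⟩
      -- By definition `chains 0 z q` is `δ z q`, so pairing with `q` is the case `j = 0`.
      extend (λ z → ι (chains 0 z q)) (fold ⟦ p ⟧ U k) ≈⟨ extend-chains-fold 0 k p q ⟩
      ι (chains (k + 0) p q)                         ≡⟨ cong (λ m → ι (chains m p q)) (ℕ.+-identityʳ k) ⟩
      ι (weight p q)                                 ∎
      where
      k : ℕ
      k = rank q ∸ rank p

    -- Division by `∣Aut∣` is trivial where morphisms exist; where none do, `u` is 0 by convention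
    -- and `chains-support` makes the count 0 as well.
    weight≈u : ∀ p q → ι (weight p q) ≈ u p q
    weight≈u p q with inhabited? (Hom-finite p q)
    ... | yes _ = K.sym (K.trans (/-identity _ (∣Aut∣-nonZero q) (∣Aut∣≡1 q)) (⟨U^,⟩≈weight p q))
    ... | no ¬h = K.reflexive (cong ι (chains-support (rank q ∸ rank p) ¬h))

    weight≈d : ∀ p q → ι (weight p q) ≈ d p q
    weight≈d p q with inhabited? (Hom-finite p q)
    ... | yes _ = K.sym (K.trans (/-identity _ (∣Aut∣-nonZero p) (∣Aut∣≡1 p)) (⟨U^,⟩≈weight p q))
    ... | no ¬h = K.reflexive (cong ι (chains-support (rank q ∸ rank p) ¬h))

theorem4p2 :
    ∀ {c ℓ₁ ℓ₂} (𝕜 : CharZeroField c ℓ₁ ℓ₂) →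
    let open CharZeroField 𝕜
        open UnivalentUpDownCategory
        open UnivalentMorphism
        open UnivalentMultiplicities 𝕜 in
    Σ[ n ∈ ((C : UnivalentUpDownCategory) → Ob C → Ob C → ℕ) ]
      (∀ C x y → (ι (n C x y) ≈ u C x y) × (ι (n C x y) ≈ d C x y)) ×
      (Σ[ isObj ∈ (∀ C → IsWeightedRelationPoset (_≼_ C) (rank C) (0̂ C) (n C)) ]
       Σ[ isMor ∈ (∀ {C D} (F : UnivalentMorphism C D) →
                    IsWeightedMorphism (wrp C (n C) (isObj C)) (wrp D (n D) (isObj D)) (F₀ F)) ]
         IsFunctor 𝔘𝔘 𝔚 (λ C → wrp C (n C) (isObj C)) (λ F → wrpMap (isMor F)))
theorem4p2 𝕜 =
    -- The integral weight is the same for every field `𝕜`.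
    (λ C → weight (upDownCategory C))
  , (λ C p q → weight≈u 𝕜 C p q , weight≈d 𝕜 C p q)
  , (λ C → isWeightedRelationPoset (upDownCategory C))
  , (λ F → record
      { rank-preserving = UnivalentMorphism.rank-preserving F
      ; n-bound         = WeightBound.weight-bound F
      })
  , record
      -- Equality in `𝔘𝔘` compares arrows with their endpoints; the source of the image of the
      -- identity arrow gives equality on objects.
      { F-resp-≈     = λ {C} F≈G p → cong proj₁ (F≈G (p , p , idm C))
      ; identity     = λ _ → refl
      ; homomorphism = λ _ _ _ → refl
      }
  where
  open ChainCount
  open UnivalentUpDownCategory using (upDownCategory; idm)
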